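{- For every integer $q\ge 4$ put $m(q)=\binom q2$. Then for every integer $q\geq 4$ there exists a real number $\epsilon=\epsilon(q)$ with $0<\epsilon<1$ such that the value of $\Sigma_{1+\epsilon}$ in the degree sequence of $QS(m(q)+1,m(q))$ is strictly less than the value of $\Sigma_{1+\epsilon}$ in the degree sequence of $K_q\oplus\overline{K}_{m(q)+1-q}$.
   Context: For a real $\beta>0$ and a finite simple graph with degree sequence $d=(d_1,\dots,d_n)$, $\Sigma_\beta(d)=\sum_{i=1}^n d_i^{\beta}$. For $m\le n-1$, the quasi-star graph $QS(n,m)$ is isomorphic to the star $K_{1,m}$ together with $n-m-1$ isolated vertices. $G\oplus H$ is the disjoint union of $G$ and $H$, and $\overline{K}_s$ is the graph consisting of $s$ isolated vertices. -}

module Defs where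

open import Algebra.Bundles using (CommutativeRing)
import Algebra.Properties.Semiring.Exp as Exp
open import Data.Bool.Base using (Bool; true; false; not)
open import Data.Empty using (⊥)
open import Data.Fin.Base using (Fin; zero; suc; splitAt)
open import Data.Fin.Properties using () renaming (_≟_ to _≟ᶠ_)
open import Data.Fin.Subset using (Subset; ∣_∣)
open import Data.Integer.Base as ℤ using (+_; -[1+_])
import Data.Integer.Properties as ℤₚ
open import Data.Nat.Base as ℕ using (ℕ; zero; suc; _∸_)
open import Data.Nat.Combinatorics using (_C_)
import Data.Nat.Properties as ℕₚ
open import Data.Product.Base using (∃-syntax; _×_; _,_)
open import Data.Rational.Base hiding (∣_∣)
open import Data.Rational.Properties
open import Data.Rational.Solver using (module +-*-Solver)
import Data.Rational.Unnormalised.Base as ℚᵘ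
import Data.Rational.Unnormalised.Properties as ℚᵘₚ
open import Data.Sum.Base using (_⊎_; inj₁; inj₂; [_,_]′)
import Data.Vec.Base as Vec
open import Data.Vec.Functional using (Vector; foldr; map)
open import Relation.Binary.Definitions using (tri<; tri≈; tri>)
open import Relation.Binary.PropositionalEquality
open import Relation.Nullary.Decidable.Core using (does; yes; no)
open import Relation.Nullary.Negation.Core using (contradiction)

open Exp (CommutativeRing.semiring +-*-commutativeRing) public
  using (_^_; ^-homo-*; ^-assocʳ)
open +-*-Solver using (solve; con; _:=_; _:+_; _:*_; _:-_)

fromℕ : ℕ → ℚ
fromℕ n = + n / 1

p<q⇒0<q-p : ∀ {p q} → p < q → 0ℚ < q - p
p<q⇒0<q-p {p} {q} p<q = subst (_< q - p) (+-inverseʳ p) (+-monoˡ-< (- p) p<q)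

q≡p+d⇒p<q : ∀ {p q d} → 0ℚ < d → q ≡ p + d → p < q
q≡p+d⇒p<q {p} {q} {d} 0<d refl =
  subst (_< p + d) (+-identityʳ p) (+-monoʳ-< p 0<d)

q≡p+d⇒p≤q : ∀ {p q d} → 0ℚ ≤ d → q ≡ p + d → p ≤ q
q≡p+d⇒p≤q {p} {q} {d} 0≤d refl =
  subst (_≤ p + d) (+-identityʳ p) (+-monoʳ-≤ p 0≤d)

0<p*q : ∀ {p q} → 0ℚ < p → 0ℚ < q → 0ℚ < p * q
0<p*q {p} {q} 0<p 0<q =
  positive⁻¹ (p * q) {{pos*pos⇒pos p {{positive 0<p}} q {{positive 0<q}}}}

0≤p*q : ∀ {p q} → 0ℚ ≤ p → 0ℚ ≤ q → 0ℚ ≤ p * q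
0≤p*q {p} {q} 0≤p 0≤q =
  nonNegative⁻¹ (p * q)
    {{nonNeg*nonNeg⇒nonNeg p {{nonNegative 0≤p}} q {{nonNegative 0≤q}}}}

0≤p+q : ∀ {p q} → 0ℚ ≤ p → 0ℚ ≤ q → 0ℚ ≤ p + q
0≤p+q = +-mono-≤

0<1 : 0ℚ < 1ℚ
0<1 = positive⁻¹ 1ℚ

*-mono-≤-0≤ : ∀ {p q r s} → 0ℚ ≤ p → 0ℚ ≤ s → p ≤ q → r ≤ s → p * r ≤ q * s
*-mono-≤-0≤ {p} {q} {r} {s} 0≤p 0≤s p≤q r≤s =
  ≤-trans (*-monoˡ-≤-nonNeg p {{nonNegative 0≤p}} r≤s)
          (*-monoʳ-≤-nonNeg s {{nonNegative 0≤s}} p≤q)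

0≤1/[1+n] : ∀ a n → 0ℚ ≤ + a / suc n
0≤1/[1+n] a n = nonNegative⁻¹ _ {{normalize-nonNeg a (suc n)}}

-- Lemmas that are opaque are so because a `with` on them would otherwise
-- normalise their proofs.
opaque
  /-mono-< : ∀ a b c d → a ℕ.* suc d ℕ.< c ℕ.* suc b → + a / suc b < + c / suc d
  /-mono-< a b c d lt = toℚᵘ-cancel-< (ℚᵘₚ.<-respˡ-≃ (ℚᵘₚ.≃-sym (toℚᵘ-fromℚᵘ (ℚᵘ.mkℚᵘ (+ a) b)))
    (ℚᵘₚ.<-respʳ-≃ (ℚᵘₚ.≃-sym (toℚᵘ-fromℚᵘ (ℚᵘ.mkℚᵘ (+ c) d)))
      (ℚᵘ.*<* (subst₂ ℤ._<_ (ℤₚ.pos-* a (suc d)) (ℤₚ.pos-* c (suc b)) (ℤ.+<+ lt)))))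

opaque
  /-cancel-< : ∀ a b c d → + a / suc b < + c / suc d → a ℕ.* suc d ℕ.< c ℕ.* suc b
  /-cancel-< a b c d lt
    with ℚᵘₚ.<-respˡ-≃ (toℚᵘ-fromℚᵘ (ℚᵘ.mkℚᵘ (+ a) b))
           (ℚᵘₚ.<-respʳ-≃ (toℚᵘ-fromℚᵘ (ℚᵘ.mkℚᵘ (+ c) d)) (toℚᵘ-mono-< lt))
  ... | ℚᵘ.*<* lt′ = ℤₚ.drop‿+<+
    (subst₂ ℤ._<_ (sym (ℤₚ.pos-* a (suc d))) (sym (ℤₚ.pos-* c (suc b))) lt′)

opaque
  p<a/[1+b] : ∀ p b → ∃[ a ] p < + a / suc b
  p<a/[1+b] (mkℚ -[1+ n ] d c) b = 0 , <-≤-trans (negative⁻¹ _) (0≤1/[1+n] 0 b)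
  p<a/[1+b] p@(mkℚ (+ n) d c) b = suc n ℕ.* suc b ,
    subst (_< + (suc n ℕ.* suc b) / suc b) (↥p/↧p≡p p) (/-mono-< n d (suc n ℕ.* suc b) b lt)
    where
    lt : n ℕ.* suc b ℕ.< suc n ℕ.* suc b ℕ.* suc d
    lt = ℕₚ.<-≤-trans (ℕₚ.*-monoˡ-< (suc b) (ℕₚ.n<1+n n))
           (ℕₚ.m≤m*n (suc n ℕ.* suc b) (suc d))

opaque
  inverse : ∀ {p} → 0ℚ < p → ∃[ q ] 0ℚ < q × p * q ≡ 1ℚ
  inverse {p} 0<p = (1/ p) {{p≢0}} , positive⁻¹ _ {{1/pos⇒pos p {{p>0}}}} , *-inverseʳ p {{p≢0}}
    where
    p>0 : Positive p
    p>0 = positive 0<p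
    p≢0 : NonZero p
    p≢0 = pos⇒nonZero p {{p>0}}

opaque
  archimedean : ∀ {p} → 0ℚ < p → ∀ q → ∃[ n ] q < fromℕ n * p
  archimedean {p} 0<p q =
    let (i , 0<i , pi≡1) = inverse 0<p
        (n , qi<n)       = p<a/[1+b] (q * i) 0
    in n , subst (_< fromℕ n * p) (undo i pi≡1) (*-monoˡ-<-pos p {{positive 0<p}} qi<n)
    where
    undo : ∀ i → p * i ≡ 1ℚ → q * i * p ≡ q
    undo i pi≡1 = trans (solve 3 (λ p i q → q :* i :* p := q :* (p :* i)) refl p i q)
                    (trans (cong (q *_) pi≡1) (*-identityʳ q))

opaque
  fromℕ-suc : ∀ n → fromℕ (suc n) ≡ 1ℚ + fromℕ n
  fromℕ-suc n = toℚᵘ-injective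
    (ℚᵘₚ.≃-trans (toℚᵘ-fromℚᵘ (ℚᵘ.mkℚᵘ (+ suc n) 0))
      (ℚᵘₚ.≃-trans (ℚᵘ.*≡* (cong (ℤ._* + 1) (sym eq)))
        (ℚᵘₚ.≃-sym (ℚᵘₚ.≃-trans (toℚᵘ-homo-+ 1ℚ (fromℕ n))
          (ℚᵘₚ.+-congʳ ℚᵘ.1ℚᵘ (toℚᵘ-fromℚᵘ (ℚᵘ.mkℚᵘ (+ n) 0)))))))
    where
    eq : + 1 ℤ.* + 1 ℤ.+ + n ℤ.* + 1 ≡ + suc n
    eq = cong (λ i → + 1 ℤ.+ i) (ℤₚ.*-identityʳ (+ n))

-- Each of the last two conclusions holds for all sufficiently small h.
opaque
  small : ∀ {c δ u} → 0ℚ ≤ c → 0ℚ < δ → 0ℚ < u →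
          ∃[ h ] 0ℚ < h × h < u × h * c < δ
  small {c} {δ} {u} 0≤c 0<δ 0<u =
    let (i , 0<i , ei≡1) = inverse 0<e
        0<h              = 0<p*q (0<p*q 0<δ 0<u) 0<i
        he≡δu            = undo i ei≡1
    in δ * u * i , 0<h , h<u (δ * u * i) 0<h he≡δu , hc<δ (δ * u * i) 0<h he≡δu
    where
    e : ℚ
    e = c * u + δ + 1ℚ
    0<e : 0ℚ < e
    0<e = +-mono-< (+-mono-≤-< (0≤p*q 0≤c (<⇒≤ 0<u)) 0<δ) 0<1
    undo : ∀ i → e * i ≡ 1ℚ → δ * u ≡ δ * u * i * e
    undo i ei≡1 = sym (trans (*-assoc (δ * u) i e) (trans (cong (δ * u *_)
      (trans (*-comm i e) ei≡1)) (*-identityʳ (δ * u))))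
    h<u : ∀ h → 0ℚ < h → δ * u ≡ h * e → h < u
    h<u h 0<h he = *-cancelˡ-<-nonNeg δ {{nonNegative (<⇒≤ 0<δ)}} (q≡p+d⇒p<q
      (+-mono-≤-< (0≤p*q (<⇒≤ 0<h) (0≤p*q 0≤c (<⇒≤ 0<u))) 0<h)
      (trans he (solve 4 (λ h c u δ →
        h :* (c :* u :+ δ :+ con 1ℚ) := δ :* h :+ (h :* (c :* u) :+ h)) refl h c u δ)))
    hc<δ : ∀ h → 0ℚ < h → δ * u ≡ h * e → h * c < δ
    hc<δ h 0<h he = *-cancelʳ-<-nonNeg u {{nonNegative (<⇒≤ 0<u)}} (q≡p+d⇒p<q
      (+-mono-≤-< (0≤p*q (<⇒≤ 0<h) (<⇒≤ 0<δ)) 0<h)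
      (trans he (solve 4 (λ h c u δ →
        h :* (c :* u :+ δ :+ con 1ℚ) := h :* c :* u :+ (h :* δ :+ h)) refl h c u δ)))

0≤p^n : ∀ {p} → 0ℚ ≤ p → ∀ n → 0ℚ ≤ p ^ n
0≤p^n 0≤p zero    = <⇒≤ 0<1
0≤p^n 0≤p (suc n) = 0≤p*q 0≤p (0≤p^n 0≤p n)

0<p^n : ∀ {p} → 0ℚ < p → ∀ n → 0ℚ < p ^ n
0<p^n 0<p zero    = 0<1
0<p^n 0<p (suc n) = 0<p*q 0<p (0<p^n 0<p n)

^-monoˡ-≤ : ∀ {p q} n → 0ℚ ≤ p → p ≤ q → p ^ n ≤ q ^ n
^-monoˡ-≤ zero    0≤p p≤q = ≤-refl
^-monoˡ-≤ (suc n) 0≤p p≤q =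
  *-mono-≤-0≤ 0≤p (0≤p^n (≤-trans 0≤p p≤q) n) p≤q (^-monoˡ-≤ n 0≤p p≤q)

^-monoˡ-< : ∀ {p q} n → 0ℚ ≤ p → p < q → p ^ suc n < q ^ suc n
^-monoˡ-< {p} {q} n 0≤p p<q = ≤-<-trans
  (*-monoˡ-≤-nonNeg p {{nonNegative 0≤p}} (^-monoˡ-≤ n 0≤p (<⇒≤ p<q)))
  (*-monoˡ-<-pos (q ^ n) {{positive (0<p^n (≤-<-trans 0≤p p<q) n)}} p<q)

1≤p^n : ∀ {p} → 1ℚ ≤ p → ∀ n → 1ℚ ≤ p ^ n
1≤p^n 1≤p zero    = ≤-refl
1≤p^n 1≤p (suc n) = *-mono-≤-0≤ (<⇒≤ 0<1)
  (≤-trans (<⇒≤ 0<1) (1≤p^n 1≤p n)) 1≤p (1≤p^n 1≤p n)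

^-monoʳ-≤ : ∀ {p m n} → 1ℚ ≤ p → m ℕ.≤ n → p ^ m ≤ p ^ n
^-monoʳ-≤ {n = n} 1≤p ℕ.z≤n = 1≤p^n 1≤p n
^-monoʳ-≤ {p} 1≤p (ℕ.s≤s m≤n) =
  *-monoˡ-≤-nonNeg p {{nonNegative (≤-trans (<⇒≤ 0<1) 1≤p)}} (^-monoʳ-≤ 1≤p m≤n)

bernoulli : ∀ {p h} → 0ℚ ≤ p → 0ℚ ≤ h → ∀ n →
            p ^ n * (p + fromℕ n * h) ≤ p * (p + h) ^ n
bernoulli {p} {h} 0≤p 0≤h zero = ≤-reflexive
  (solve 2 (λ p h → con 1ℚ :* (p :+ con 0ℚ :* h) := p :* con 1ℚ) refl p h)
bernoulli {p} {h} 0≤p 0≤h (suc n) = begin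
  p * p ^ n * (p + fromℕ (suc n) * h)
    ≡⟨ cong (λ k → p * p ^ n * (p + k * h)) (fromℕ-suc n) ⟩
  p * p ^ n * (p + (1ℚ + k) * h)
    ≤⟨ q≡p+d⇒p≤q (0≤p*q (0≤p^n 0≤p n) (0≤p*q (0≤1/[1+n] n 0) (0≤p*q 0≤h 0≤h)))
         (solve 4 (λ p h k x → (p :+ h) :* (x :* (p :+ k :* h))
            := p :* x :* (p :+ (con 1ℚ :+ k) :* h) :+ x :* (k :* (h :* h)))
          refl p h k (p ^ n)) ⟩
  (p + h) * (p ^ n * (p + k * h))
    ≤⟨ *-monoˡ-≤-nonNeg (p + h) {{nonNegative (0≤p+q 0≤p 0≤h)}} (bernoulli 0≤p 0≤h n) ⟩
  (p + h) * (p * (p + h) ^ n)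
    ≡⟨ solve 3 (λ s p x → s :* (p :* x) := p :* (s :* x)) refl (p + h) p ((p + h) ^ n) ⟩
  p * ((p + h) * (p + h) ^ n) ∎
  where
  open ≤-Reasoning
  k = fromℕ n

opaque
  ^-dominates : ∀ {p q} → 0ℚ < p → p < q → ∀ c → ∃[ n ] c * p ^ suc n < q ^ suc n
  ^-dominates {p} {q} 0<p p<q c = go (archimedean 0<h (c * p))
    where
    open ≤-Reasoning
    h : ℚ
    h = q - p
    0<h : 0ℚ < h
    0<h = p<q⇒0<q-p p<q
    instance
      p>0 : Positive p
      p>0 = positive 0<p
    p+h≡q : p + h ≡ q
    p+h≡q = solve 2 (λ p q → p :+ (q :- p) := q) refl p q
    rotate : ∀ x → p * (c * x) ≡ x * (c * p)
    rotate x = solve 3 (λ p c x → p :* (c :* x) := x :* (c :* p)) refl p c x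
    step : ∀ k h → 0ℚ < h → k * h ≤ p + (1ℚ + k) * h
    step k h 0<h = q≡p+d⇒p≤q {d = p + h} (<⇒≤ (+-mono-< 0<p 0<h))
      (solve 3 (λ p h k → p :+ (con 1ℚ :+ k) :* h := k :* h :+ (p :+ h)) refl p h k)
    go : ∃[ n ] c * p < fromℕ n * h → ∃[ n ] c * p ^ suc n < q ^ suc n
    go (n , lt) = n , *-cancelˡ-<-nonNeg p {{pos⇒nonNeg p}} (begin-strict
      p * (c * p ^ suc n)
        ≡⟨ rotate (p ^ suc n) ⟩
      p ^ suc n * (c * p)
        <⟨ *-monoʳ-<-pos (p ^ suc n) {{positive (0<p^n 0<p (suc n))}} lt ⟩
      p ^ suc n * (fromℕ n * h)
        ≤⟨ *-monoˡ-≤-nonNeg (p ^ suc n) {{nonNegative (0≤p^n (<⇒≤ 0<p) (suc n))}}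
             (step (fromℕ n) h 0<h) ⟩
      p ^ suc n * (p + (1ℚ + fromℕ n) * h)
        ≡⟨ cong (λ k → p ^ suc n * (p + k * h)) (fromℕ-suc n) ⟨
      p ^ suc n * (p + fromℕ (suc n) * h)
        ≤⟨ bernoulli (<⇒≤ 0<p) (<⇒≤ 0<h) (suc n) ⟩
      p * (p + h) ^ suc n
        ≡⟨ cong (λ x → p * x ^ suc n) p+h≡q ⟩
      p * q ^ suc n ∎)

-- lipschitz n b bounds the slope of x ↦ xⁿ on [0 , b].
lipschitz : ℕ → ℚ → ℚ
lipschitz zero    b = 0ℚ
lipschitz (suc n) b = b ^ n + b * lipschitz n b

0≤lipschitz : ∀ n {b} → 0ℚ ≤ b → 0ℚ ≤ lipschitz n b
0≤lipschitz zero    0≤b = ≤-refl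
0≤lipschitz (suc n) 0≤b = 0≤p+q (0≤p^n 0≤b n) (0≤p*q 0≤b (0≤lipschitz n 0≤b))

^-lipschitz : ∀ n {p h b} → 0ℚ ≤ p → 0ℚ ≤ h → p + h ≤ b →
              (p + h) ^ n ≤ p ^ n + h * lipschitz n b
^-lipschitz zero {h = h} 0≤p 0≤h p+h≤b = ≤-reflexive
  (solve 1 (λ h → con 1ℚ := con 1ℚ :+ h :* con 0ℚ) refl h)
^-lipschitz (suc n) {p} {h} {b} 0≤p 0≤h p+h≤b = begin
  (p + h) * (p + h) ^ n
    ≤⟨ *-monoˡ-≤-nonNeg (p + h) {{nonNegative 0≤p+h}} (^-lipschitz n 0≤p 0≤h p+h≤b) ⟩
  (p + h) * (p ^ n + h * l)
    ≡⟨ solve 4 (λ p h x l → (p :+ h) :* (x :+ h :* l)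
         := p :* x :+ h :* (x :+ (p :+ h) :* l)) refl p h (p ^ n) l ⟩
  p * p ^ n + h * (p ^ n + (p + h) * l)
    ≤⟨ +-monoʳ-≤ (p * p ^ n) (*-monoˡ-≤-nonNeg h {{nonNegative 0≤h}}
         (+-mono-≤ (^-monoˡ-≤ n 0≤p p≤b)
                   (*-monoʳ-≤-nonNeg l {{nonNegative (0≤lipschitz n 0≤b)}} p+h≤b))) ⟩
  p * p ^ n + h * (b ^ n + b * l) ∎
  where
  open ≤-Reasoning
  l = lipschitz n b
  0≤p+h = 0≤p+q 0≤p 0≤h
  0≤b = ≤-trans 0≤p+h p+h≤b
  p≤b = ≤-trans (q≡p+d⇒p≤q 0≤h refl) p+h≤b

opaque
  ^-<-open : ∀ n {p c} → 0ℚ ≤ p → p ^ n < c → ∃[ q ] p < q × q ^ n < c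
  ^-<-open n {p} {c} 0≤p lt
    with small (0≤lipschitz n (0≤p+q 0≤p (<⇒≤ 0<1))) (p<q⇒0<q-p lt) 0<1
  ... | h , 0<h , h<1 , hl<δ = p + h , q≡p+d⇒p<q 0<h refl , ≤-<-trans
    (^-lipschitz n 0≤p (<⇒≤ 0<h) (+-monoʳ-≤ p (<⇒≤ h<1)))
    (subst (p ^ n + h * lipschitz n (p + 1ℚ) <_)
      (solve 2 (λ x c → x :+ (c :- x) := c) refl (p ^ n) c)
      (+-monoʳ-< (p ^ n) hl<δ))

opaque
  ^->-open : ∀ n {p c} → 0ℚ < p → c < p ^ n → ∃[ q ] q < p × 0ℚ < q × c < q ^ n
  ^->-open n {p} {c} 0<p lt
    with small (0≤lipschitz n (<⇒≤ 0<p)) (p<q⇒0<q-p lt) 0<p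
  ... | h , 0<h , h<p , hl<δ = p - h , q≡p+d⇒p<q 0<h eq , p<q⇒0<q-p h<p ,
    +-cancelʳ-< (h * l) (begin-strict
      c + h * l               <⟨ +-monoʳ-< c hl<δ ⟩
      c + (p ^ n - c)         ≡⟨ solve 2 (λ c x → c :+ (x :- c) := x) refl c (p ^ n) ⟩
      p ^ n                   ≡⟨ cong (_^ n) eq ⟩
      (p - h + h) ^ n         ≤⟨ ^-lipschitz n (<⇒≤ (p<q⇒0<q-p h<p)) (<⇒≤ 0<h)
                                   (≤-reflexive (sym eq)) ⟩
      (p - h) ^ n + h * l     ∎)
    where
    open ≤-Reasoning
    l : ℚ
    l = lipschitz n p
    eq : p ≡ p - h + h
    eq = solve 2 (λ p h → p := p :- h :+ h) refl p h
    +-cancelʳ-< : ∀ r {p q} → p + r < q + r → p < q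
    +-cancelʳ-< r {p} {q} p+r<q+r = subst₂ _<_ (s p) (s q) (+-monoˡ-< (- r) p+r<q+r)
      where
      s : ∀ p → p + r - r ≡ p
      s p = solve 2 (λ p r → p :+ r :- r := p) refl p r

-- Dedekind reals: L and U are the sets of rationals strictly below and
-- strictly above the number.
record ℝ : Set₁ where
  field
    L U         : ℚ → Set
    L-inhabited : ∃[ p ] L p
    U-inhabited : ∃[ p ] U p
    L-lower     : ∀ {p q} → p < q → L q → L p
    U-upper     : ∀ {p q} → p < q → U p → U q
    L-open      : ∀ {p} → L p → ∃[ q ] p < q × L q
    U-open      : ∀ {q} → U q → ∃[ p ] p < q × U p
    disjoint    : ∀ {p} → L p → U p → ⊥
    located     : ∀ {p q} → p < q → L p ⊎ U q

open ℝ

L<U : ∀ x {p q} → L x p → U x q → p < q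
L<U x {p} {q} Lp Uq with <-cmp p q
... | tri< p<q _ _  = p<q
... | tri≈ _ refl _ = contradiction Uq (disjoint x Lp)
... | tri> _ _ q<p  = contradiction Uq (disjoint x (L-lower x q<p Lp))

infix 4 _<ℝ_

_<ℝ_ : ℝ → ℝ → Set
x <ℝ y = ∃[ p ] U x p × L y p

fromℚ : ℚ → ℝ
fromℚ r = record
  { L = _< r
  ; U = r <_
  ; L-inhabited = r - 1ℚ , q≡p+d⇒p<q 0<1 (solve 1 (λ r → r := r :- con 1ℚ :+ con 1ℚ) refl r)
  ; U-inhabited = r + 1ℚ , q≡p+d⇒p<q 0<1 refl
  ; L-lower     = <-trans
  ; U-upper     = λ p<q r<p → <-trans r<p p<q
  ; L-open      = <-dense
  ; U-open      = λ r<q → let (p , r<p , p<q) = <-dense r<q in p , p<q , r<p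
  ; disjoint    = <-asym
  ; located     = loc
  }
  where
  loc : ∀ {p q} → p < q → p < r ⊎ r < q
  loc {p} p<q with p <? r
  ... | yes p<r = inj₁ p<r
  ... | no  p≮r = inj₂ (≤-<-trans (≮⇒≥ p≮r) p<q)

0ℝ 1ℝ : ℝ
0ℝ = fromℚ 0ℚ
1ℝ = fromℚ 1ℚ

opaque
  bracket : ∀ x (f : ℕ → ℚ) → (∀ n → f n < f (suc n)) →
            L x (f 0) → ∀ n → U x (f n) → ∃[ a ] L x (f a) × U x (f (2 ℕ.+ a))
  bracket x f f-inc L0 zero    U0 = contradiction U0 (disjoint x L0)
  bracket x f f-inc L0 (suc n) Un with located x (f-inc 1)
  ... | inj₂ U2 = 0 , L0 , U2
  ... | inj₁ L1 with bracket x (λ a → f (suc a)) (λ a → f-inc (suc a)) L1 n Un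
  ...   | a , La , Ua = suc a , La , Ua

opaque
  approximate : ∀ x {h} → 0ℚ < h → ∃[ p ] L x p × U x (p + (h + h))
  approximate x {h} 0<h with L-inhabited x | U-inhabited x
  ... | p , Lp | q , Uq with archimedean 0<h (q - p)
  ...   | n , lt = let (a , La , Ua) = bracket x f f-inc Lf0 n Ufn in
    f a , La , subst (U x) (trans (f-suc (suc a)) (trans (cong (_+ h) (f-suc a)) (+-assoc (f a) h h))) Ua
    where
    f : ℕ → ℚ
    f a = p + fromℕ a * h
    f-suc : ∀ a → f (suc a) ≡ f a + h
    f-suc a = trans (cong (λ k → p + k * h) (fromℕ-suc a))
      (solve 3 (λ p k h → p :+ (con 1ℚ :+ k) :* h := p :+ k :* h :+ h) refl p (fromℕ a) h)
    f-inc : ∀ a → f a < f (suc a)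
    f-inc a = q≡p+d⇒p<q 0<h (f-suc a)
    Lf0 : L x (f 0)
    Lf0 = subst (L x) (solve 2 (λ p h → p := p :+ con 0ℚ :* h) refl p h) Lp
    Ufn : U x (f n)
    Ufn = U-upper x (subst (_< f n) (solve 2 (λ p q → p :+ (q :- p) := q) refl p q)
            (+-monoʳ-< p lt)) Uq

infixl 6 _+ℝ_

_+ℝ_ : ℝ → ℝ → ℝ
x +ℝ y = record
  { L = λ r → ∃[ p ] ∃[ q ] L x p × L y q × r ≡ p + q
  ; U = λ r → ∃[ p ] ∃[ q ] U x p × U y q × r ≡ p + q
  ; L-inhabited = let (p , Lp) = L-inhabited x; (q , Lq) = L-inhabited y in
                  p + q , p , q , Lp , Lq , refl
  ; U-inhabited = let (p , Up) = U-inhabited x; (q , Uq) = U-inhabited y in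
                  p + q , p , q , Up , Uq , refl
  ; L-lower = λ { {r} r<s (p , q , Lp , Lq , refl) →
      r - q , q , L-lower x (subst (r - q <_) (cancel p q) (+-monoˡ-< (- q) r<s)) Lp , Lq , restore r q }
  ; U-upper = λ { {_} {s} r<s (p , q , Up , Uq , refl) →
      s - q , q , U-upper x (subst (_< s - q) (cancel p q) (+-monoˡ-< (- q) r<s)) Up , Uq , restore s q }
  ; L-open = λ { (p , q , Lp , Lq , refl) → let (p′ , p<p′ , Lp′) = L-open x Lp in
      p′ + q , +-monoˡ-< q p<p′ , p′ , q , Lp′ , Lq , refl }
  ; U-open = λ { (p , q , Up , Uq , refl) → let (p′ , p′<p , Up′) = U-open x Up in
      p′ + q , +-monoˡ-< q p′<p , p′ , q , Up′ , Uq , refl }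
  ; disjoint = λ { (p , q , Lp , Lq , r≡p+q) (p′ , q′ , Up′ , Uq′ , r≡p′+q′) →
      <-irrefl (trans (sym r≡p+q) r≡p′+q′) (+-mono-< (L<U x Lp Up′) (L<U y Lq Uq′)) }
  ; located = loc
  }
  where
  cancel : ∀ p q → p + q - q ≡ p
  cancel = solve 2 (λ p q → p :+ q :- q := p) refl
  restore : ∀ p q → p ≡ p - q + q
  restore = solve 2 (λ p q → p := p :- q :+ q) refl
  narrow : ∀ {r s p d} → d < s - r → r - p < s - (p + (½ * d + ½ * d))
  narrow {r} {s} {p} {d} d<s-r = q≡p+d⇒p<q (p<q⇒0<q-p d<s-r)
    (solve 4 (λ r s p d → s :- (p :+ (con ½ :* d :+ con ½ :* d))
      := r :- p :+ (s :- r :- d)) refl r s p d)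
  complement : ∀ p r → r ≡ p + (r - p)
  complement = solve 2 (λ p r → r := p :+ (r :- p)) refl
  loc : ∀ {r s} → r < s →
        (∃[ p ] ∃[ q ] L x p × L y q × r ≡ p + q) ⊎ (∃[ p ] ∃[ q ] U x p × U y q × s ≡ p + q)
  loc {r} {s} r<s =
    let (d , 0<d , d<s-r) = <-dense (p<q⇒0<q-p r<s)
        (p , Lp , Up)     = approximate x (0<p*q (positive⁻¹ ½) 0<d)
    in [ (λ Lq → inj₁ (p , r - p , Lp , Lq , complement p r))
       , (λ Uq → inj₂ (_ , _ , Up , Uq , complement (p + (½ * d + ½ * d)) s))
       ]′ (located y (narrow {r} {s} {p} {d} d<s-r))

0<1+ : ∀ x → 0ℝ <ℝ x → 0ℝ <ℝ 1ℝ +ℝ x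
0<1+ x (p , 0<p , Lp) =
  ½ + p , +-mono-< (positive⁻¹ ½) 0<p , ½ , p ,
  toℚᵘ-cancel-< (ℚᵘ.*<* (ℤ.+<+ (ℕ.s≤s (ℕ.s≤s ℕ.z≤n)))) , Lp , refl

-- 0^β is 0 for β > 0.  For N ≥ 1, N^β is the supremum of the N^(a/(1+b))
-- over the rationals 0 ≤ a/(1+b) < β, and the infimum of the N^(a/(1+b))
-- over the rationals a/(1+b) > β; the comparison of r with N^(a/(1+b)) is
-- expressed by comparing r^(1+b) with N^a.
module _ (N : ℚ) (β : ℝ) where

  L^ U^ : ℚ → Set
  L^ r = r < 0ℚ ⊎ ∃[ a ] ∃[ b ] L β (+ a / suc b) × r ^ suc b < N ^ a
  U^ r = 0ℚ < r × ∃[ a ] ∃[ b ] U β (+ a / suc b) × N ^ a < r ^ suc b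

  L^-lower : ∀ {p q} → p < q → L^ q → L^ p
  L^-lower p<q (inj₁ q<0) = inj₁ (<-trans p<q q<0)
  L^-lower {p} p<q (inj₂ (a , b , La , lt)) with p <? 0ℚ
  ... | yes p<0 = inj₁ p<0
  ... | no  p≮0 = inj₂ (a , b , La , <-trans (^-monoˡ-< b (≮⇒≥ p≮0) p<q) lt)

  U^-upper : ∀ {p q} → p < q → U^ p → U^ q
  U^-upper p<q (0<p , a , b , Ua , lt) =
    <-trans 0<p p<q , a , b , Ua , <-trans lt (^-monoˡ-< b (<⇒≤ 0<p) p<q)

  L^-open : ∀ {p} → L^ p → ∃[ q ] p < q × L^ q
  L^-open (inj₁ p<0) = let (q , p<q , q<0) = <-dense p<0 in q , p<q , inj₁ q<0
  L^-open {p} (inj₂ (a , b , La , lt)) with p <? 0ℚ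
  ... | yes p<0 = let (q , p<q , q<0) = <-dense p<0 in q , p<q , inj₁ q<0
  ... | no  p≮0 = let (q , p<q , lt′) = ^-<-open (suc b) (≮⇒≥ p≮0) lt in
                  q , p<q , inj₂ (a , b , La , lt′)

  U^-open : ∀ {q} → U^ q → ∃[ p ] p < q × U^ p
  U^-open (0<q , a , b , Ua , lt) =
    let (p , p<q , 0<p , lt′) = ^->-open (suc b) 0<q lt in
    p , p<q , 0<p , a , b , Ua , lt′

  U^-inhabited : 1ℚ ≤ N → ∃[ p ] U^ p
  U^-inhabited 1≤N =
    let (q , Uq)   = U-inhabited β
        (a , q<a)  = p<a/[1+b] q 0
        0≤Nᵃ       = 0≤p^n (≤-trans (<⇒≤ 0<1) 1≤N) a
    in N ^ a + 1ℚ , +-mono-≤-< 0≤Nᵃ 0<1 , a , 0 , U-upper β q<a Uq ,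
       q≡p+d⇒p<q 0<1 (*-identityʳ (N ^ a + 1ℚ))

  ^-disjoint : 1ℚ ≤ N → ∀ {p} → L^ p → U^ p → ⊥
  ^-disjoint 1≤N (inj₁ p<0) (0<p , _) = <-asym p<0 0<p
  ^-disjoint 1≤N {p} (inj₂ (a , b , La , lt)) (0<p , c , d , Uc , lt′) =
    <-irrefl refl (begin-strict
      (p ^ suc b) ^ suc d   <⟨ ^-monoˡ-< d (0≤p^n (<⇒≤ 0<p) (suc b)) lt ⟩
      (N ^ a) ^ suc d       ≡⟨ ^-assocʳ N a (suc d) ⟩
      N ^ (a ℕ.* suc d)     ≤⟨ ^-monoʳ-≤ 1≤N (ℕₚ.<⇒≤ (/-cancel-< a b c d (L<U β La Uc))) ⟩
      N ^ (c ℕ.* suc b)     ≡⟨ ^-assocʳ N c (suc b) ⟨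
      (N ^ c) ^ suc b       <⟨ ^-monoˡ-< b (0≤p^n 0≤N c) lt′ ⟩
      (p ^ suc d) ^ suc b   ≡⟨ ^-assocʳ p (suc d) (suc b) ⟩
      p ^ (suc d ℕ.* suc b) ≡⟨ cong (p ^_) (ℕₚ.*-comm (suc d) (suc b)) ⟩
      p ^ (suc b ℕ.* suc d) ≡⟨ ^-assocʳ p (suc b) (suc d) ⟨
      (p ^ suc b) ^ suc d   ∎)
    where
    open ≤-Reasoning
    0≤N = ≤-trans (<⇒≤ 0<1) 1≤N

  ^-located : 1ℚ ≤ N → 0ℝ <ℝ β → ∀ {p q} → p < q → L^ p ⊎ U^ q
  ^-located 1≤N (z , 0<z , Lz) {p} {q} p<q with <-cmp p 0ℚ
  ... | tri< p<0 _ _  = inj₁ (inj₁ p<0)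
  ... | tri≈ _ refl _ = inj₁ (inj₂ (0 , 0 , L-lower β 0<z Lz , 0<1))
  ... | tri> _ _ 0<p with ^-dominates 0<p p<q (N ^ 2)
  ...   | b , N²pᵇ<qᵇ with U-inhabited β
  ...     | u , Uu with p<a/[1+b] u b
  ...       | n , u<n with bracket β (λ a → + a / suc b)
                (λ a → /-mono-< a b (suc a) b (ℕₚ.*-monoˡ-< (suc b) (ℕₚ.n<1+n a)))
                (L-lower β (subst (_< z) (sym (0/n≡0 (suc b))) 0<z) Lz)
                n (U-upper β u<n Uu)
  ...         | a , La , Ua with p ^ suc b <? N ^ a
  ...           | yes pᵇ<Nᵃ = inj₁ (inj₂ (a , b , La , pᵇ<Nᵃ))
  ...           | no  pᵇ≮Nᵃ = inj₂ (<-trans 0<p p<q , 2 ℕ.+ a , b , Ua , (begin-strict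
      N ^ (2 ℕ.+ a)     ≡⟨ ^-homo-* N 2 a ⟩
      N ^ 2 * N ^ a     ≤⟨ *-monoˡ-≤-nonNeg (N ^ 2) {{nonNegative (0≤p^n 0≤N 2)}} (≮⇒≥ pᵇ≮Nᵃ) ⟩
      N ^ 2 * p ^ suc b <⟨ N²pᵇ<qᵇ ⟩
      q ^ suc b         ∎))
    where
    open ≤-Reasoning
    0≤N = ≤-trans (<⇒≤ 0<1) 1≤N

1≤fromℕ-suc : ∀ n → 1ℚ ≤ fromℕ (suc n)
1≤fromℕ-suc n = q≡p+d⇒p≤q (0≤1/[1+n] n 0) (fromℕ-suc n)

power : ℕ → (β : ℝ) → 0ℝ <ℝ β → ℝ
power zero    β 0<β = 0ℝ
power (suc n) β 0<β = record
  { L = L^ N β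
  ; U = U^ N β
  ; L-inhabited = - 1ℚ , inj₁ (negative⁻¹ (- 1ℚ))
  ; U-inhabited = U^-inhabited N β 1≤N
  ; L-lower     = L^-lower N β
  ; U-upper     = U^-upper N β
  ; L-open      = L^-open N β
  ; U-open      = U^-open N β
  ; disjoint    = ^-disjoint N β 1≤N
  ; located     = ^-located N β 1≤N 0<β
  }
  where
  N = fromℕ (suc n)
  1≤N = 1≤fromℕ-suc n

powerSum : (β : ℝ) → 0ℝ <ℝ β → ∀ {n} → Vector ℕ n → ℝ
powerSum β 0<β d = foldr _+ℝ_ 0ℝ (map (λ k → power k β 0<β) d)

record Graph : Set where
  field
    order  : ℕ
    adj    : Fin order → Fin order → Bool
    irrefl : ∀ i → adj i i ≡ false
    symm   : ∀ i j → adj i j ≡ adj j i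

open Graph

neighbours : (G : Graph) → Fin (order G) → Subset (order G)
neighbours G i = Vec.tabulate (adj G i)

degrees : (G : Graph) → Vector ℕ (order G)
degrees G i = ∣ neighbours G i ∣

complete : ℕ → Graph
complete n = record
  { order  = n
  ; adj    = λ i j → not (does (i ≟ᶠ j))
  ; irrefl = irr
  ; symm   = sy
  }
  where
  irr : ∀ (i : Fin n) → not (does (i ≟ᶠ i)) ≡ false
  irr i with i ≟ᶠ i
  ... | yes _  = refl
  ... | no i≢i = contradiction refl i≢i
  sy : ∀ (i j : Fin n) → not (does (i ≟ᶠ j)) ≡ not (does (j ≟ᶠ i))
  sy i j with i ≟ᶠ j | j ≟ᶠ i
  ... | yes _   | yes _   = refl
  ... | no _    | no _    = refl
  ... | yes i≡j | no j≢i  = contradiction (sym i≡j) j≢i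
  ... | no i≢j  | yes j≡i = contradiction (sym j≡i) i≢j

empty : ℕ → Graph
empty n = record
  { order  = n
  ; adj    = λ _ _ → false
  ; irrefl = λ _ → refl
  ; symm   = λ _ _ → refl
  }

star : ℕ → Graph
star m = record
  { order  = suc m
  ; adj    = a
  ; irrefl = λ { zero → refl ; (suc _) → refl }
  ; symm   = λ { zero zero → refl ; zero (suc _) → refl ; (suc _) zero → refl ; (suc _) (suc _) → refl }
  }
  where
  a : Fin (suc m) → Fin (suc m) → Bool
  a zero    zero    = false
  a zero    (suc _) = true
  a (suc _) zero    = true
  a (suc _) (suc _) = false

infixr 6 _⊕_

_⊕_ : Graph → Graph → Graph
G ⊕ H = record
  { order  = order G ℕ.+ order H
  ; adj    = λ i j → a (splitAt (order G) i) (splitAt (order G) j)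
  ; irrefl = λ i → irr (splitAt (order G) i)
  ; symm   = λ i j → sy (splitAt (order G) i) (splitAt (order G) j)
  }
  where
  V = Fin (order G) ⊎ Fin (order H)
  a : V → V → Bool
  a (inj₁ i) (inj₁ j) = adj G i j
  a (inj₂ i) (inj₂ j) = adj H i j
  a (inj₁ _) (inj₂ _) = false
  a (inj₂ _) (inj₁ _) = false
  irr : ∀ v → a v v ≡ false
  irr (inj₁ i) = irrefl G i
  irr (inj₂ i) = irrefl H i
  sy : ∀ v w → a v w ≡ a w v
  sy (inj₁ i) (inj₁ j) = symm G i j
  sy (inj₂ i) (inj₂ j) = symm H i j
  sy (inj₁ _) (inj₂ _) = refl
  sy (inj₂ _) (inj₁ _) = refl

-- The quasi-star graph for m ≤ n - 1 only; this bound is what keeps ∸ from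
-- truncating.
QS : (n m : ℕ) → .(m ℕ.< n) → Graph
QS n m _ = star m ⊕ empty (n ∸ m ∸ 1)

m[_] : ℕ → ℕ
m[ q ] = q C 2

{-# OPTIONS --safe #-}

-- Write P = q - 1 and m = m(q) = P (P + 1) / 2, so that q P = 2 m.  Dividing by m,
-- the claim is m^ε + 1 < 2 P^ε.  At ε = 0 both sides are 2, and the derivatives
-- are log m < 2 log P because m < P², so small ε work.  A quantitative version
-- without logarithms: for h = 1 / (9 P) let n be such that
-- (1 + h)^(n+1) < P < (1 + h)^(n+3).  Then (1 + 2h)^n, which is almost (1 + h)^(2n),
-- still exceeds m, and the X slightly below 1 + 2h and Y = 1 + h satisfy X + 1 < 2 Y,
-- m < X^n and Y^(n+1) < P; any ε strictly between 1 / (n+1) and 1 / n will do.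
module Submission where

open import Defs
open import Algebra.Bundles using (CommutativeRing)
import Algebra.Properties.CommutativeSemiring.Exp as CommutativeExp
import Algebra.Properties.Monoid.Sum as MonoidSum
open import Data.Bool.Base using (Bool; true; false)
open import Data.Fin.Base using (Fin; zero; suc; splitAt)
open import Data.Fin.Subset using (∣_∣)
open import Data.Integer.Base using (+_)
open import Data.Nat.Base using (ℕ; zero; suc; s≤s; _≤_; _<_; _+_; _*_; _∸_; z<s)
open import Data.Nat.Combinatorics using (_C_; nC1≡n; nCk+nC[k+1]≡[n+1]C[k+1])
open import Data.Nat.Properties using (+-comm; +-identityʳ; *-monoʳ-<; m<m+n; m≤n+m; n<1+n)
open import Data.Product.Base using (Σ-syntax; ∃-syntax; _×_; _,_)
open import Data.Rational.Base as ℚ using (ℚ; 0ℚ; 1ℚ; ½; _/_)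
import Data.Rational.Properties as ℚₚ
open import Data.Rational.Solver using (module +-*-Solver)
import Data.Rational.Unnormalised.Base as ℚᵘ
import Data.Rational.Unnormalised.Properties as ℚᵘₚ
open import Data.Sum.Base as Sum using (_⊎_; inj₁; inj₂; [_,_])
open import Data.Vec.Base using (tabulate)
open import Data.Vec.Functional using (Vector; _++_; _∷_; map)
open import Data.Vec.Functional.Relation.Binary.Pointwise.Properties using (foldr-cong)
open import Data.Vec.Properties using (tabulate-cong)
open import Function.Base using (_∘_; const; id)
open import Relation.Binary.PropositionalEquality
  using (_≡_; refl; sym; trans; cong; cong₂; subst; subst₂; module ≡-Reasoning)
open import Relation.Nullary.Decidable.Core using (yes; no)

open CommutativeExp (CommutativeRing.commutativeSemiring ℚₚ.+-*-commutativeRing)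
  using (^-distrib-*)
open MonoidSum ℚₚ.+-0-monoid using (sum; sum-cong-≗)
open +-*-Solver using (solve; con; _:=_; _:+_; _:*_; _:-_)
open ℝ
open Graph

-- Binomial coefficients and Bernoulli inequalities over the rationals.

fromℕ-+ : ∀ m n → fromℕ (m + n) ≡ fromℕ m ℚ.+ fromℕ n
fromℕ-+ zero    n = sym (ℚₚ.+-identityˡ (fromℕ n))
fromℕ-+ (suc m) n = begin
  fromℕ (suc (m + n))             ≡⟨ fromℕ-suc (m + n) ⟩
  1ℚ ℚ.+ fromℕ (m + n)            ≡⟨ cong (1ℚ ℚ.+_) (fromℕ-+ m n) ⟩
  1ℚ ℚ.+ (fromℕ m ℚ.+ fromℕ n)    ≡⟨ ℚₚ.+-assoc 1ℚ (fromℕ m) (fromℕ n) ⟨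
  1ℚ ℚ.+ fromℕ m ℚ.+ fromℕ n      ≡⟨ cong (ℚ._+ fromℕ n) (fromℕ-suc m) ⟨
  fromℕ (suc m) ℚ.+ fromℕ n       ∎
  where open ≡-Reasoning

fromℕ-C2 : ∀ n → fromℕ (suc n C 2) ≡ ½ ℚ.* (fromℕ n ℚ.* (fromℕ n ℚ.+ 1ℚ))
fromℕ-C2 zero    = refl
fromℕ-C2 (suc n) = begin
  fromℕ (suc (suc n) C 2)
    ≡⟨ cong fromℕ (nCk+nC[k+1]≡[n+1]C[k+1] (suc n) 1) ⟨
  fromℕ (suc n C 1 + suc n C 2)
    ≡⟨ fromℕ-+ (suc n C 1) (suc n C 2) ⟩
  fromℕ (suc n C 1) ℚ.+ fromℕ (suc n C 2)
    ≡⟨ cong₂ ℚ._+_ (trans (cong fromℕ (nC1≡n (suc n))) (fromℕ-suc n)) (fromℕ-C2 n) ⟩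
  1ℚ ℚ.+ N ℚ.+ ½ ℚ.* (N ℚ.* (N ℚ.+ 1ℚ))
    ≡⟨ solve 1 (λ N → con 1ℚ :+ N :+ con ½ :* (N :* (N :+ con 1ℚ))
         := con ½ :* ((con 1ℚ :+ N) :* (con 1ℚ :+ N :+ con 1ℚ))) refl N ⟩
  ½ ℚ.* ((1ℚ ℚ.+ N) ℚ.* (1ℚ ℚ.+ N ℚ.+ 1ℚ))
    ≡⟨ cong (λ x → ½ ℚ.* (x ℚ.* (x ℚ.+ 1ℚ))) (fromℕ-suc n) ⟨
  ½ ℚ.* (fromℕ (suc n) ℚ.* (fromℕ (suc n) ℚ.+ 1ℚ)) ∎
  where
  open ≡-Reasoning
  N = fromℕ n

1^n≡1 : ∀ n → 1ℚ ^ n ≡ 1ℚ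
1^n≡1 zero    = refl
1^n≡1 (suc n) = trans (ℚₚ.*-identityˡ (1ℚ ^ n)) (1^n≡1 n)

1+nh≤[1+h]^n : ∀ {h} → 0ℚ ℚ.≤ h → ∀ n → 1ℚ ℚ.+ fromℕ n ℚ.* h ℚ.≤ (1ℚ ℚ.+ h) ^ n
1+nh≤[1+h]^n {h} 0≤h n = subst₂ ℚ._≤_
  (trans (cong (ℚ._* (1ℚ ℚ.+ fromℕ n ℚ.* h)) (1^n≡1 n)) (ℚₚ.*-identityˡ _))
  (ℚₚ.*-identityˡ _)
  (bernoulli (ℚₚ.<⇒≤ 0<1) 0≤h n)

-- Bernoulli for a negative increment, by induction: multiplying the bound for n by 1 - u, which is
-- nonnegative, exceeds the bound for n + 1 by n u².
1-nu≤[1-u]^n : ∀ {u} → 0ℚ ℚ.≤ u → 0ℚ ℚ.≤ 1ℚ ℚ.- u → ∀ n →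
               1ℚ ℚ.- fromℕ n ℚ.* u ℚ.≤ (1ℚ ℚ.- u) ^ n
1-nu≤[1-u]^n {u} 0≤u 0≤1-u zero = ℚₚ.≤-reflexive
  (solve 1 (λ u → con 1ℚ :- con 0ℚ :* u := con 1ℚ) refl u)
1-nu≤[1-u]^n {u} 0≤u 0≤1-u (suc n) = begin
  1ℚ ℚ.- fromℕ (suc n) ℚ.* u
    ≡⟨ cong (λ k → 1ℚ ℚ.- k ℚ.* u) (fromℕ-suc n) ⟩
  1ℚ ℚ.- (1ℚ ℚ.+ fromℕ n) ℚ.* u
    ≤⟨ q≡p+d⇒p≤q (0≤p*q (0≤1/[1+n] n 0) (0≤p*q 0≤u 0≤u))
         (solve 2 (λ k u → (con 1ℚ :- u) :* (con 1ℚ :- k :* u)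
           := con 1ℚ :- (con 1ℚ :+ k) :* u :+ k :* (u :* u)) refl (fromℕ n) u) ⟩
  (1ℚ ℚ.- u) ℚ.* (1ℚ ℚ.- fromℕ n ℚ.* u)
    ≤⟨ ℚₚ.*-monoˡ-≤-nonNeg (1ℚ ℚ.- u) {{ℚ.nonNegative 0≤1-u}} (1-nu≤[1-u]^n 0≤u 0≤1-u n) ⟩
  (1ℚ ℚ.- u) ℚ.* (1ℚ ℚ.- u) ^ n ∎
  where open ℚₚ.≤-Reasoning

-- The rational numbers X and Y.

module _ {P h : ℚ} (3≤P : fromℕ 3 ℚ.≤ P) (0<h : 0ℚ ℚ.< h) (Ph≡1/9 : P ℚ.* h ≡ + 1 / 9) where

  private
    Y = 1ℚ ℚ.+ h
    W = 1ℚ ℚ.+ (h ℚ.+ h)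
    0≤h = ℚₚ.<⇒≤ 0<h
    0<P = ℚₚ.<-≤-trans (ℚₚ.positive⁻¹ (fromℕ 3)) 3≤P
    0≤P = ℚₚ.<⇒≤ 0<P
    0<Y = ℚₚ.+-mono-< 0<1 0<h
    0≤Y = ℚₚ.<⇒≤ 0<Y
    1<Y = q≡p+d⇒p<q {p = 1ℚ} 0<h refl
    3h≤1/9 : fromℕ 3 ℚ.* h ℚ.≤ + 1 / 9
    3h≤1/9 = subst (fromℕ 3 ℚ.* h ℚ.≤_) Ph≡1/9
      (ℚₚ.*-monoʳ-≤-nonNeg h {{ℚ.nonNegative 0≤h}} 3≤P)
    h≤1 : h ℚ.≤ 1ℚ
    h≤1 = ℚₚ.≤-trans (q≡p+d⇒p≤q (ℚₚ.+-mono-≤ 0≤h 0≤h)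
        (solve 1 (λ h → con (fromℕ 3) :* h := h :+ (h :+ h)) refl h))
      (ℚₚ.≤-trans 3h≤1/9 (q≡p+d⇒p≤q {d = + 8 / 9} (0≤1/[1+n] 8 8) refl))
    0≤1-h : 0ℚ ℚ.≤ 1ℚ ℚ.- h
    0≤1-h = subst (ℚ._≤ 1ℚ ℚ.- h) (ℚₚ.+-inverseʳ h) (ℚₚ.+-monoˡ-≤ (ℚ.- h) h≤1)
    0≤1-h² : 0ℚ ℚ.≤ 1ℚ ℚ.- h ℚ.* h
    0≤1-h² = subst (0ℚ ℚ.≤_)
      (solve 1 (λ h → (con 1ℚ :- h) :* (con 1ℚ :+ h) := con 1ℚ :- h :* h) refl h)
      (0≤p*q 0≤1-h 0≤Y)

  -- The search for n starts at exponent 2, so that n is at least 1 and 1 / n makes sense.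
  Y²<P : Y ^ 2 ℚ.< P
  Y²<P = begin-strict
    Y ^ 2
      ≤⟨ q≡p+d⇒p≤q (0≤p*q 0≤h 0≤1-h) (solve 1 (λ h → con 1ℚ :+ con (fromℕ 3) :* h
           := (con 1ℚ :+ h) :* ((con 1ℚ :+ h) :* con 1ℚ) :+ h :* (con 1ℚ :- h)) refl h) ⟩
    1ℚ ℚ.+ fromℕ 3 ℚ.* h
      ≤⟨ ℚₚ.+-monoʳ-≤ 1ℚ 3h≤1/9 ⟩
    1ℚ ℚ.+ + 1 / 9
      <⟨ q≡p+d⇒p<q {d = + 17 / 9} (ℚₚ.positive⁻¹ (+ 17 / 9)) refl ⟩
    fromℕ 3
      ≤⟨ 3≤P ⟩
    P ∎
    where open ℚₚ.≤-Reasoning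

  -- The powers of Y increase and are unbounded, so `bracket`, applied to the cut of P, finds where
  -- they pass P. It fixes the place only up to two steps; with n = 1 + a the exponents are n + 1
  -- and n + 3.
  Y-bracket : ∃[ a ] Y ^ (2 + a) ℚ.< P × P ℚ.< Y ^ (4 + a)
  Y-bracket =
    let (n , lt) = ^-dominates 0<1 1<Y P
        P<Yⁿ     = subst (ℚ._< Y ^ suc n) (trans (cong (P ℚ.*_) (1^n≡1 (suc n))) (ℚₚ.*-identityʳ P)) lt
    in bracket (fromℚ P) (λ a → Y ^ (2 + a)) inc Y²<P n
         (ℚₚ.<-≤-trans P<Yⁿ (^-monoʳ-≤ (ℚₚ.<⇒≤ 1<Y) (m≤n+m (suc n) 1)))
    where
    inc : ∀ a → Y ^ (2 + a) ℚ.< Y ^ (3 + a)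
    inc a = subst (ℚ._< Y ^ (3 + a)) (ℚₚ.*-identityˡ (Y ^ (2 + a)))
      (ℚₚ.*-monoˡ-<-pos (Y ^ (2 + a)) {{ℚ.positive (0<p^n 0<Y (2 + a))}} 1<Y)

  -- Since (1 - h) Y ≤ 1, dividing by Y³ loses no more than multiplying by (1 - h)³.
  P-1/3≤Yⁿ : ∀ n → P ℚ.< Y ^ (3 + n) → P ℚ.- + 1 / 3 ℚ.≤ Y ^ n
  P-1/3≤Yⁿ n P<Y = begin
    P ℚ.- + 1 / 3
      ≡⟨ trans (cong (λ x → P ℚ.- fromℕ 3 ℚ.* x) (sym Ph≡1/9))
           (solve 2 (λ P h → P :- con (fromℕ 3) :* (P :* h)
             := (con 1ℚ :- con (fromℕ 3) :* h) :* P) refl P h) ⟩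
    (1ℚ ℚ.- fromℕ 3 ℚ.* h) ℚ.* P
      ≤⟨ *-mono-≤ʳ 0≤P (1-nu≤[1-u]^n 0≤h 0≤1-h 3) ⟩
    (1ℚ ℚ.- h) ^ 3 ℚ.* P
      ≤⟨ ℚₚ.*-monoˡ-≤-nonNeg ((1ℚ ℚ.- h) ^ 3) {{ℚ.nonNegative (0≤p^n 0≤1-h 3)}} (ℚₚ.<⇒≤ P<Y) ⟩
    (1ℚ ℚ.- h) ^ 3 ℚ.* Y ^ (3 + n)
      ≡⟨ trans (cong ((1ℚ ℚ.- h) ^ 3 ℚ.*_) (^-homo-* Y 3 n))
           (trans (sym (ℚₚ.*-assoc ((1ℚ ℚ.- h) ^ 3) (Y ^ 3) (Y ^ n)))
             (cong (ℚ._* Y ^ n) (sym (^-distrib-* (1ℚ ℚ.- h) Y 3)))) ⟩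
    ((1ℚ ℚ.- h) ℚ.* Y) ^ 3 ℚ.* Y ^ n
      ≤⟨ *-mono-≤ʳ (0≤p^n 0≤Y n) (^-monoˡ-≤ 3 (0≤p*q 0≤1-h 0≤Y)
           (q≡p+d⇒p≤q (0≤p*q 0≤h 0≤h)
             (solve 1 (λ h → con 1ℚ := (con 1ℚ :- h) :* (con 1ℚ :+ h) :+ h :* h) refl h))) ⟩
    1ℚ ^ 3 ℚ.* Y ^ n
      ≡⟨ ℚₚ.*-identityˡ (Y ^ n) ⟩
    Y ^ n ∎
    where
    open ℚₚ.≤-Reasoning
    *-mono-≤ʳ : ∀ {x y z} → 0ℚ ℚ.≤ z → x ℚ.≤ y → x ℚ.* z ℚ.≤ y ℚ.* z
    *-mono-≤ʳ {z = z} 0≤z = ℚₚ.*-monoʳ-≤-nonNeg z {{ℚ.nonNegative 0≤z}}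

  -- Bernoulli gives n h ≤ Y^n ≤ P, hence n h² ≤ P h = 1/9, and Bernoulli for 1 - h² loses at most n
  -- h².
  8/9≤[1-h²]ⁿ : ∀ n → Y ^ suc n ℚ.< P → + 8 / 9 ℚ.≤ (1ℚ ℚ.- h ℚ.* h) ^ n
  8/9≤[1-h²]ⁿ n Y<P = begin
    + 8 / 9
      ≡⟨ cong (λ x → 1ℚ ℚ.- x) Ph≡1/9 ⟨
    1ℚ ℚ.- P ℚ.* h
      ≤⟨ ℚₚ.+-monoʳ-≤ 1ℚ (ℚₚ.neg-antimono-≤
           (ℚₚ.*-monoʳ-≤-nonNeg h {{ℚ.nonNegative 0≤h}} nh≤P)) ⟩
    1ℚ ℚ.- fromℕ n ℚ.* h ℚ.* h
      ≡⟨ cong (λ x → 1ℚ ℚ.- x) (ℚₚ.*-assoc (fromℕ n) h h) ⟩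
    1ℚ ℚ.- fromℕ n ℚ.* (h ℚ.* h)
      ≤⟨ 1-nu≤[1-u]^n (0≤p*q 0≤h 0≤h) 0≤1-h² n ⟩
    (1ℚ ℚ.- h ℚ.* h) ^ n ∎
    where
    open ℚₚ.≤-Reasoning
    nh≤P : fromℕ n ℚ.* h ℚ.≤ P
    nh≤P = begin
      fromℕ n ℚ.* h             ≤⟨ q≡p+d⇒p≤q (ℚₚ.<⇒≤ 0<1) (ℚₚ.+-comm 1ℚ (fromℕ n ℚ.* h)) ⟩
      1ℚ ℚ.+ fromℕ n ℚ.* h      ≤⟨ 1+nh≤[1+h]^n 0≤h n ⟩
      Y ^ n                     ≤⟨ ^-monoʳ-≤ (ℚₚ.<⇒≤ 1<Y) (m≤n+m n 1) ⟩
      Y ^ suc n                 <⟨ Y<P ⟩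
      P                         ∎

  P[P+1]/2<8/9[P-1/3]² :
    ½ ℚ.* (P ℚ.* (P ℚ.+ 1ℚ)) ℚ.< (P ℚ.- + 1 / 3) ℚ.* (P ℚ.- + 1 / 3) ℚ.* (+ 8 / 9)
  P[P+1]/2<8/9[P-1/3]² = q≡p+d⇒p<q
    (ℚₚ.+-mono-≤-< (0≤p+q (0≤p*q (0≤1/[1+n] 7 17) (0≤p*q 0≤s 0≤s))
                         (0≤p*q (0≤1/[1+n] 67 53) 0≤s))
      (ℚₚ.positive⁻¹ (+ 26 / 81)))
    -- the difference expanded in powers of P - 3 has positive coefficients
    (solve 1 (λ P → (P :- con (+ 1 / 3)) :* (P :- con (+ 1 / 3)) :* con (+ 8 / 9)
      := con ½ :* (P :* (P :+ con 1ℚ))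
         :+ (con (+ 7 / 18) :* ((P :- con (fromℕ 3)) :* (P :- con (fromℕ 3)))
         :+ con (+ 67 / 54) :* (P :- con (fromℕ 3)) :+ con (+ 26 / 81))) refl P)
    where
    0≤s : 0ℚ ℚ.≤ P ℚ.- fromℕ 3
    0≤s = ℚₚ.+-monoˡ-≤ (ℚ.- fromℕ 3) 3≤P

  -- W is at least Y² (1 - h²), so W^n is at least (Y^n)² (1 - h²)^n. The first factor costs the
  -- shift of P by 1/3 = 3 P h, the second the factor 8/9; the quadratic inequality above absorbs
  -- both losses once P is at least 3.
  P[P+1]/2<Wⁿ : ∀ n → Y ^ suc n ℚ.< P → P ℚ.< Y ^ (3 + n) →
                ½ ℚ.* (P ℚ.* (P ℚ.+ 1ℚ)) ℚ.< W ^ n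
  P[P+1]/2<Wⁿ n Y<P P<Y = begin-strict
    ½ ℚ.* (P ℚ.* (P ℚ.+ 1ℚ))
      <⟨ P[P+1]/2<8/9[P-1/3]² ⟩
    c ℚ.* c ℚ.* (+ 8 / 9)
      ≤⟨ *-mono-≤-0≤ (0≤p*q 0≤c 0≤c) (0≤p^n 0≤1-h² n)
           (*-mono-≤-0≤ 0≤c (0≤p^n 0≤Y n) (P-1/3≤Yⁿ n P<Y) (P-1/3≤Yⁿ n P<Y)) (8/9≤[1-h²]ⁿ n Y<P) ⟩
    Y ^ n ℚ.* Y ^ n ℚ.* (1ℚ ℚ.- h ℚ.* h) ^ n
      ≡⟨ trans (cong (ℚ._* (1ℚ ℚ.- h ℚ.* h) ^ n) (sym (^-distrib-* Y Y n)))
           (sym (^-distrib-* (Y ℚ.* Y) (1ℚ ℚ.- h ℚ.* h) n)) ⟩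
    (Y ℚ.* Y ℚ.* (1ℚ ℚ.- h ℚ.* h)) ^ n
      ≤⟨ ^-monoˡ-≤ n (0≤p*q (0≤p*q 0≤Y 0≤Y) 0≤1-h²)
           (q≡p+d⇒p≤q (0≤p*q (0≤p*q 0≤h 0≤h) (0≤p+q (0≤p+q 0≤h 0≤h) (0≤p*q 0≤h 0≤h)))
             (solve 1 (λ h → con 1ℚ :+ (h :+ h)
               := (con 1ℚ :+ h) :* (con 1ℚ :+ h) :* (con 1ℚ :- h :* h)
                  :+ h :* h :* (h :+ h :+ h :* h)) refl h)) ⟩
    W ^ n ∎
    where
    open ℚₚ.≤-Reasoning
    c = P ℚ.- + 1 / 3
    0≤c : 0ℚ ℚ.≤ c
    0≤c = ℚₚ.≤-trans (0≤1/[1+n] 8 2) (ℚₚ.+-monoˡ-≤ (ℚ.- (+ 1 / 3)) 3≤P)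

  -- W + 1 equals Y + Y exactly. Since the bound on W^n is strict, W can be lowered to some X that
  -- keeps this bound and makes X + 1 < Y + Y strict. Here n = 1 + b.
  roots : ∃[ b ] ∃[ X ] ∃[ Y ] 0ℚ ℚ.< X × 0ℚ ℚ.< Y ×
          ½ ℚ.* (P ℚ.* (P ℚ.+ 1ℚ)) ℚ.< X ^ suc b × Y ^ (2 + b) ℚ.< P × X ℚ.+ 1ℚ ℚ.< Y ℚ.+ Y
  roots =
    let (b , Y<P , P<Y)     = Y-bracket
        (X , X<W , 0<X , lt) = ^->-open (suc b) (ℚₚ.+-mono-< 0<1 (ℚₚ.+-mono-< 0<h 0<h))
                                 (P[P+1]/2<Wⁿ (suc b) Y<P P<Y)
    in b , X , Y , 0<X , 0<Y , lt , Y<P ,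
       subst (X ℚ.+ 1ℚ ℚ.<_)
         (solve 1 (λ h → con 1ℚ :+ (h :+ h) :+ con 1ℚ := con 1ℚ :+ h :+ (con 1ℚ :+ h)) refl h)
         (ℚₚ.+-monoˡ-< 1ℚ X<W)

opaque
  approximate-roots : ∀ {P} → fromℕ 3 ℚ.≤ P → ∃[ b ] ∃[ X ] ∃[ Y ] 0ℚ ℚ.< X × 0ℚ ℚ.< Y ×
    ½ ℚ.* (P ℚ.* (P ℚ.+ 1ℚ)) ℚ.< X ^ suc b × Y ^ (2 + b) ℚ.< P × X ℚ.+ 1ℚ ℚ.< Y ℚ.+ Y
  approximate-roots {P} 3≤P =
    let (i , 0<i , Pi≡1) = inverse (ℚₚ.<-≤-trans (ℚₚ.positive⁻¹ (fromℕ 3)) 3≤P)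
    -- The value taken for h is (1/9) i = 1 / (9 P).
    in roots 3≤P (0<p*q (ℚₚ.positive⁻¹ (+ 1 / 9)) 0<i)
         (trans (solve 2 (λ P i → P :* (con (+ 1 / 9) :* i) := con (+ 1 / 9) :* (P :* i)) refl P i)
           (trans (cong (+ 1 / 9 ℚ.*_) Pi≡1) (ℚₚ.*-identityʳ (+ 1 / 9))))

-- Rational bounds for reals and their powers.

opaque
  -- Brings the exponent 1 + 1/n, where n = 1 + b, into the form a / (1 + b) used by the cuts of
  -- `power`.
  1+1/[1+b]≡[2+b]/[1+b] : ∀ b → 1ℚ ℚ.+ + 1 / suc b ≡ + (2 + b) / suc b
  1+1/[1+b]≡[2+b]/[1+b] b = ℚₚ.toℚᵘ-injective
    (ℚᵘₚ.≃-trans (ℚₚ.toℚᵘ-homo-+ 1ℚ (+ 1 / suc b))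
      (ℚᵘₚ.≃-trans (ℚᵘₚ.+-congʳ ℚᵘ.1ℚᵘ (ℚₚ.toℚᵘ-fromℚᵘ (ℚᵘ.mkℚᵘ (+ 1) b)))
        (ℚᵘₚ.≃-trans (ℚᵘ.*≡* (cong +_ eq))
          (ℚᵘₚ.≃-sym (ℚₚ.toℚᵘ-fromℚᵘ (ℚᵘ.mkℚᵘ (+ (2 + b)) b))))))
    where
    eq : (suc b + 0 + 1) * suc b ≡ (2 + b) * (suc b + 0)
    eq = cong₂ _*_ (trans (cong (_+ 1) (+-identityʳ (suc b))) (+-comm (suc b) 1))
      (sym (+-identityʳ (suc b)))

infix 4 _≼_ _≽_

-- The non-strict orders between a real and a rational. Strict ones would not do: isolated vertices
-- contribute exactly 0, and leaves exactly 1.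
_≼_ _≽_ : ℝ → ℚ → Set
x ≼ r = ∀ {s} → r ℚ.< s → U x s
x ≽ r = ∀ {s} → s ℚ.< r → L x s

-- Half of the gap between p + q and s goes to each summand. The gap may have either sign, so both
-- additivity lemmas use this identity.
split-gap : ∀ p q s → s ≡ (p ℚ.+ ½ ℚ.* (s ℚ.- (p ℚ.+ q))) ℚ.+ (q ℚ.+ ½ ℚ.* (s ℚ.- (p ℚ.+ q)))
split-gap = solve 3 (λ p q s → s := (p :+ con ½ :* (s :- (p :+ q))) :+ (q :+ con ½ :* (s :- (p :+ q)))) refl

≼-+ : ∀ x p y q → x ≼ p → y ≼ q → x +ℝ y ≼ p ℚ.+ q
≼-+ x p y q x≼p y≼q {s} p+q<s = _ , _ , x≼p (above p) , y≼q (above q) , split-gap p q s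
  where
  0<g : 0ℚ ℚ.< ½ ℚ.* (s ℚ.- (p ℚ.+ q))
  0<g = 0<p*q (ℚₚ.positive⁻¹ ½) (p<q⇒0<q-p p+q<s)
  above : ∀ r → r ℚ.< r ℚ.+ ½ ℚ.* (s ℚ.- (p ℚ.+ q))
  above r = q≡p+d⇒p<q 0<g refl

≽-+ : ∀ x p y q → x ≽ p → y ≽ q → x +ℝ y ≽ p ℚ.+ q
≽-+ x p y q x≽p y≽q {s} s<p+q = _ , _ , x≽p (below p) , y≽q (below q) , split-gap p q s
  where
  0<g : 0ℚ ℚ.< ½ ℚ.* (p ℚ.+ q ℚ.- s)
  0<g = 0<p*q (ℚₚ.positive⁻¹ ½) (p<q⇒0<q-p s<p+q)
  below : ∀ r → r ℚ.+ ½ ℚ.* (s ℚ.- (p ℚ.+ q)) ℚ.< r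
  below r = q≡p+d⇒p<q 0<g
    (solve 3 (λ r s t → r := r :+ con ½ :* (s :- t) :+ con ½ :* (t :- s)) refl r s (p ℚ.+ q))

-- One fraction a / (1 + b) above β serves every s > c, since then N^a ≤ c^(1+b) < s^(1+b).
power-≼ : ∀ N β (0<β : 0ℝ <ℝ β) a b c → 0ℚ ℚ.≤ c → U β (+ a / suc b) →
          fromℕ N ^ a ℚ.≤ c ^ suc b → power N β 0<β ≼ c
power-≼ zero    β 0<β a b c 0≤c Ua le c<s = ℚₚ.≤-<-trans 0≤c c<s
power-≼ (suc N) β 0<β a b c 0≤c Ua le c<s =
  ℚₚ.≤-<-trans 0≤c c<s , a , b , Ua , ℚₚ.≤-<-trans le (^-monoˡ-< b 0≤c c<s)

power-≽ : ∀ N β (0<β : 0ℝ <ℝ β) a b c → L β (+ a / suc b) →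
          c ^ suc b ℚ.≤ fromℕ (suc N) ^ a → power (suc N) β 0<β ≽ c
power-≽ N β 0<β a b c La le {s} s<c with s ℚₚ.<? 0ℚ
-- Monotonicity of powers is available only for nonnegative s; negative rationals lie in the lower
-- cut by definition.
... | yes s<0 = inj₁ s<0
... | no  s≮0 = inj₂ (a , b , La , ℚₚ.<-≤-trans (^-monoˡ-< b (ℚₚ.≮⇒≥ s≮0) s<c) le)

-- Degree sequences of the graphs.

∣tabulate-splitAt∣ : ∀ {m n} (f : Fin m ⊎ Fin n → Bool) →
  ∣ tabulate (f ∘ splitAt m) ∣ ≡ ∣ tabulate (f ∘ inj₁) ∣ + ∣ tabulate (f ∘ inj₂) ∣
∣tabulate-splitAt∣ {zero}  f = refl
-- `splitAt (suc m) (suc i)` computes to `Sum.map suc id (splitAt m i)`, which dictates the function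
-- in the induction hypothesis.
∣tabulate-splitAt∣ {suc m} f with f (inj₁ zero) | ∣tabulate-splitAt∣ {m} (f ∘ Sum.map suc id)
... | true  | eq = cong suc eq
... | false | eq = eq

∣tabulate-true∣ : ∀ n → ∣ tabulate {n = n} (const true) ∣ ≡ n
∣tabulate-true∣ zero    = refl
∣tabulate-true∣ (suc n) = cong suc (∣tabulate-true∣ n)

∣tabulate-false∣ : ∀ n → ∣ tabulate {n = n} (const false) ∣ ≡ 0
∣tabulate-false∣ zero    = refl
∣tabulate-false∣ (suc n) = ∣tabulate-false∣ n

-- A named copy of the adjacency function local to `_⊕_`, so that `∣tabulate-splitAt∣` can be
-- applied to it.
adj⊎ : (G H : Graph) (v w : Fin (order G) ⊎ Fin (order H)) → Bool
adj⊎ G H (inj₁ i) (inj₁ j) = adj G i j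
adj⊎ G H (inj₂ i) (inj₂ j) = adj H i j
adj⊎ G H _        _        = false

adj-⊕ : ∀ G H i j → adj (G ⊕ H) i j ≡ adj⊎ G H (splitAt (order G) i) (splitAt (order G) j)
adj-⊕ G H i j with splitAt (order G) i | splitAt (order G) j
... | inj₁ _ | inj₁ _ = refl
... | inj₁ _ | inj₂ _ = refl
... | inj₂ _ | inj₁ _ = refl
... | inj₂ _ | inj₂ _ = refl

degrees-⊕ : ∀ G H i → degrees (G ⊕ H) i ≡ (degrees G ++ degrees H) i
degrees-⊕ G H i = trans (cong ∣_∣ (tabulate-cong (adj-⊕ G H i))) (degree (splitAt (order G) i))
  where
  degree : ∀ v → ∣ tabulate (adj⊎ G H v ∘ splitAt (order G)) ∣ ≡ [ degrees G , degrees H ] v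
  degree (inj₁ v) = trans (∣tabulate-splitAt∣ (adj⊎ G H (inj₁ v)))
    (trans (cong (λ k → degrees G v + k) (∣tabulate-false∣ (order H))) (+-identityʳ (degrees G v)))
  degree (inj₂ v) = trans (∣tabulate-splitAt∣ (adj⊎ G H (inj₂ v)))
    (cong (_+ degrees H v) (∣tabulate-false∣ (order G)))

degrees-empty : ∀ n i → degrees (empty n) i ≡ 0
degrees-empty n i = ∣tabulate-false∣ n

degrees-star-centre : ∀ m → degrees (star m) zero ≡ m
degrees-star-centre = ∣tabulate-true∣

degrees-star-leaf : ∀ m i → degrees (star m) (suc i) ≡ 1
degrees-star-leaf m i = cong suc (∣tabulate-false∣ m)

-- Deleting vertex `zero` takes one neighbour from `suc i` and leaves the next smaller complete
-- graph.
degrees-complete : ∀ n i → degrees (complete (suc n)) i ≡ n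
degrees-complete n       zero    = ∣tabulate-true∣ n
degrees-complete (suc n) (suc i) = cong suc (degrees-complete n i)

-- Bounds for power sums of degree sequences.

sum-++ : ∀ {m n} (c : Vector ℚ m) (d : Vector ℚ n) → sum (c ++ d) ≡ sum c ℚ.+ sum d
sum-++ {zero}  c d = sym (ℚₚ.+-identityˡ (sum d))
sum-++ {suc m} c d = trans
  (cong (c zero ℚ.+_) (trans (sum-cong-≗ shift) (sum-++ (c ∘ suc) d)))
  (sym (ℚₚ.+-assoc (c zero) (sum (c ∘ suc)) (sum d)))
  where
  shift : ∀ i → (c ++ d) (suc i) ≡ ((c ∘ suc) ++ d) i
  shift i with splitAt m i
  ... | inj₁ _ = refl
  ... | inj₂ _ = refl

sum-const : ∀ n c → sum {n} (const c) ≡ fromℕ n ℚ.* c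
sum-const zero    c = sym (ℚₚ.*-zeroˡ c)
sum-const (suc n) c = trans (cong (c ℚ.+_) (sum-const n c))
  (trans (solve 2 (λ k c → c :+ k :* c := (con 1ℚ :+ k) :* c) refl (fromℕ n) c)
    (cong (ℚ._* c) (sym (fromℕ-suc n))))

-- Rewriting with this equation avoids unfolding powerSum to a record of cuts
-- when the two graphs are compared.
star-⊕-empty≡QS : ∀ {n m} .(m<n : m < n) → star m ⊕ empty (n ∸ m ∸ 1) ≡ QS n m m<n
star-⊕-empty≡QS m<n = refl

module _ (_∼_ : ℝ → ℚ → Set) (0∼0 : 0ℝ ∼ 0ℚ)
         (∼-+ : ∀ x p y q → x ∼ p → y ∼ q → (x +ℝ y) ∼ (p ℚ.+ q))
         (β : ℝ) (0<β : 0ℝ <ℝ β) where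

  -- `_∼_` stands for `_≼_` or `_≽_`. Both hold between the zeros and respect addition, so a single
  -- fold yields upper and lower bounds.
  powerSum-∼ : ∀ {n} (d : Vector ℕ n) (c : Vector ℚ n) →
               (∀ i → power (d i) β 0<β ∼ c i) → powerSum β 0<β d ∼ sum c
  powerSum-∼ d c d∼c = foldr-cong {R = _∼_} {S = _∼_} {f = _+ℝ_} {g = ℚ._+_}
    (λ {x} {p} {y} {q} → ∼-+ x p y q) 0∼0
    {xs = map (λ k → power k β 0<β) d} {ys = c} d∼c

  -- Isolated vertices have power 0, so padding the rational bounds with zeros leaves their sum
  -- unchanged.
  powerSum-⊕-empty-∼ : ∀ G n (c : Vector ℚ (order G)) →
    (∀ i → power (degrees G i) β 0<β ∼ c i) → powerSum β 0<β (degrees (G ⊕ empty n)) ∼ sum c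
  powerSum-⊕-empty-∼ G n c G∼c =
    subst (powerSum β 0<β (degrees (G ⊕ empty n)) ∼_)
      (trans (sum-++ c (const {B = Fin n} 0ℚ))
        (trans (cong (sum c ℚ.+_) (trans (sum-const n 0ℚ) (ℚₚ.*-zeroʳ (fromℕ n))))
          (ℚₚ.+-identityʳ (sum c))))
      (powerSum-∼ (degrees (G ⊕ empty n)) (c ++ const 0ℚ) λ i →
        subst (λ k → power k β 0<β ∼ (c ++ const 0ℚ) i)
          (sym (degrees-⊕ G (empty n) i)) (vertex (splitAt (order G) i)))
    where
    vertex : ∀ v → power ([ degrees G , degrees (empty n) ] v) β 0<β ∼ [ c , const 0ℚ ] v
    vertex (inj₁ i) = G∼c i
    vertex (inj₂ i) = subst (λ k → power k β 0<β ∼ 0ℚ) (sym (degrees-empty n i)) 0∼0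

  powerSum-QS-∼ : ∀ n m c .(m<n : m < n) → power m β 0<β ∼ c → power 1 β 0<β ∼ 1ℚ →
                  powerSum β 0<β (degrees (QS n m m<n)) ∼ (c ℚ.+ fromℕ m)
  powerSum-QS-∼ n m c m<n m∼c 1∼1 =
    subst₂ (λ G r → powerSum β 0<β (degrees G) ∼ r)
      (star-⊕-empty≡QS m<n)
      (cong (c ℚ.+_) (trans (sum-const m 1ℚ) (ℚₚ.*-identityʳ (fromℕ m))))
      (powerSum-⊕-empty-∼ (star m) (n ∸ m ∸ 1) (c ∷ const 1ℚ) λ
        { zero    → subst (λ k → power k β 0<β ∼ c) (sym (degrees-star-centre m)) m∼c
        ; (suc i) → subst (λ k → power k β 0<β ∼ 1ℚ) (sym (degrees-star-leaf m i)) 1∼1 })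

  powerSum-complete-∼ : ∀ p n c → power p β 0<β ∼ c →
    powerSum β 0<β (degrees (complete (suc p) ⊕ empty n)) ∼ (fromℕ (suc p) ℚ.* c)
  powerSum-complete-∼ p n c p∼c =
    subst (powerSum β 0<β (degrees (complete (suc p) ⊕ empty n)) ∼_) (sum-const (suc p) c)
      (powerSum-⊕-empty-∼ (complete (suc p)) n (const c) λ i →
        subst (λ k → power k β 0<β ∼ c) (sym (degrees-complete p i)) p∼c)

-- Powers with exponent 1 + e.

fromℚ-≼ : ∀ r → fromℚ r ≼ r
fromℚ-≼ r r<s = r<s

fromℚ-≽ : ∀ r → fromℚ r ≽ r
fromℚ-≽ r s<r = s<r

module _ (e : ℚ) (0<β : 0ℝ <ℝ 1ℝ +ℝ fromℚ e) where

  -- With n = 1 + b, the exponent is below (n + 1) / n, and N^(n+1) = N · N^n ≤ X^n N^n = (N X)^n.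
  power-1+e-≼ : ∀ N b X → e ℚ.< + 1 / suc b → 0ℚ ℚ.≤ X → fromℕ N ℚ.≤ X ^ suc b →
                power N (1ℝ +ℝ fromℚ e) 0<β ≼ fromℕ N ℚ.* X
  power-1+e-≼ N b X e<1/n 0≤X N≤Xⁿ = power-≼ N (1ℝ +ℝ fromℚ e) 0<β (2 + b) b
    (fromℕ N ℚ.* X) (0≤p*q 0≤N 0≤X)
    (≼-+ 1ℝ 1ℚ (fromℚ e) e (fromℚ-≼ 1ℚ) (fromℚ-≼ e)
      (subst (1ℚ ℚ.+ e ℚ.<_) (1+1/[1+b]≡[2+b]/[1+b] b) (ℚₚ.+-monoʳ-< 1ℚ e<1/n)))
    (begin
      fromℕ N ℚ.* fromℕ N ^ suc b
        ≤⟨ ℚₚ.*-monoʳ-≤-nonNeg (fromℕ N ^ suc b) {{ℚ.nonNegative (0≤p^n 0≤N (suc b))}} N≤Xⁿ ⟩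
      X ^ suc b ℚ.* fromℕ N ^ suc b
        ≡⟨ ℚₚ.*-comm (X ^ suc b) (fromℕ N ^ suc b) ⟩
      fromℕ N ^ suc b ℚ.* X ^ suc b
        ≡⟨ ^-distrib-* (fromℕ N) X (suc b) ⟨
      (fromℕ N ℚ.* X) ^ suc b ∎)
    where
    open ℚₚ.≤-Reasoning
    0≤N = 0≤1/[1+n] N 0

  -- The mirror image: the exponent is above (n + 1) / n, and (M Y)^n = M^n Y^n ≤ M^(n+1).
  power-1+e-≽ : ∀ N b Y → + 1 / suc b ℚ.< e → Y ^ suc b ℚ.≤ fromℕ (suc N) →
                power (suc N) (1ℝ +ℝ fromℚ e) 0<β ≽ fromℕ (suc N) ℚ.* Y
  power-1+e-≽ N b Y 1/n<e Yⁿ≤N = power-≽ N (1ℝ +ℝ fromℚ e) 0<β (2 + b) b (M ℚ.* Y)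
    (≽-+ 1ℝ 1ℚ (fromℚ e) e (fromℚ-≽ 1ℚ) (fromℚ-≽ e)
      (subst (ℚ._< 1ℚ ℚ.+ e) (1+1/[1+b]≡[2+b]/[1+b] b) (ℚₚ.+-monoʳ-< 1ℚ 1/n<e)))
    (begin
      (M ℚ.* Y) ^ suc b
        ≡⟨ ^-distrib-* M Y (suc b) ⟩
      M ^ suc b ℚ.* Y ^ suc b
        ≤⟨ ℚₚ.*-monoˡ-≤-nonNeg (M ^ suc b)
             {{ℚ.nonNegative (0≤p^n (0≤1/[1+n] (suc N) 0) (suc b))}} Yⁿ≤N ⟩
      M ^ suc b ℚ.* M
        ≡⟨ ℚₚ.*-comm (M ^ suc b) M ⟩
      M ℚ.* M ^ suc b ∎)
    where
    open ℚₚ.≤-Reasoning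
    M = fromℕ (suc N)

  power-1-≼ : ∀ b → e ℚ.< + 1 / suc b → power 1 (1ℝ +ℝ fromℚ e) 0<β ≼ 1ℚ
  power-1-≼ b e<1/n = power-1+e-≼ 1 b 1ℚ e<1/n (ℚₚ.<⇒≤ 0<1) (ℚₚ.≤-reflexive (sym (1^n≡1 (suc b))))

-- Comparison of the two power sums.

≼-≽⇒<ℝ : ∀ x y {p q} → x ≼ p → y ≽ q → p ℚ.< q → x <ℝ y
≼-≽⇒<ℝ x y x≼p y≽q p<q = let (r , p<r , r<q) = ℚₚ.<-dense p<q in r , x≼p p<r , y≽q r<q

-- This is X + 1 < Y + Y multiplied by the number M of edges, because (1 + P) P = 2 M is the degree
-- sum of the complete graph.
sums-< : ∀ P {X Y} → 0ℚ ℚ.< P → X ℚ.+ 1ℚ ℚ.< Y ℚ.+ Y →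
         let M = ½ ℚ.* (P ℚ.* (P ℚ.+ 1ℚ)) in M ℚ.* X ℚ.+ M ℚ.< (1ℚ ℚ.+ P) ℚ.* (P ℚ.* Y)
sums-< P {X} {Y} 0<P lt = begin-strict
  M ℚ.* X ℚ.+ M
    ≡⟨ solve 2 (λ M X → M :* X :+ M := M :* (X :+ con 1ℚ)) refl M X ⟩
  M ℚ.* (X ℚ.+ 1ℚ)
    <⟨ ℚₚ.*-monoʳ-<-pos M {{ℚ.positive 0<M}} lt ⟩
  M ℚ.* (Y ℚ.+ Y)
    ≡⟨ solve 2 (λ P Y → con ½ :* (P :* (P :+ con 1ℚ)) :* (Y :+ Y)
         := (con 1ℚ :+ P) :* (P :* Y)) refl P Y ⟩
  (1ℚ ℚ.+ P) ℚ.* (P ℚ.* Y) ∎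
  where
  open ℚₚ.≤-Reasoning
  M = ½ ℚ.* (P ℚ.* (P ℚ.+ 1ℚ))
  0<M : 0ℚ ℚ.< M
  0<M = 0<p*q (ℚₚ.positive⁻¹ ½) (0<p*q 0<P (ℚₚ.+-mono-< 0<P 0<1))

3≤fromℕ-3+n : ∀ n → fromℕ 3 ℚ.≤ fromℕ (3 + n)
3≤fromℕ-3+n n = q≡p+d⇒p≤q (0≤1/[1+n] n 0) (fromℕ-+ 3 n)

1/[1+b]≤1 : ∀ b → + 1 / suc b ℚ.≤ 1ℚ
1/[1+b]≤1 zero    = ℚₚ.≤-refl
1/[1+b]≤1 (suc b) = ℚₚ.<⇒≤ (/-mono-< 1 (suc b) 1 0 (s≤s z<s))

theorem9 : (q : ℕ) → 4 ≤ q →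
    Σ[ ε ∈ ℝ ] Σ[ 0<ε ∈ 0ℝ <ℝ ε ] (ε <ℝ 1ℝ) ×
    (powerSum (1ℝ +ℝ ε) (0<1+ ε 0<ε) (degrees (QS (m[ q ] + 1) m[ q ] (m<m+n m[ q ] z<s)))
    <ℝ powerSum (1ℝ +ℝ ε) (0<1+ ε 0<ε) (degrees (complete q ⊕ empty (m[ q ] + 1 ∸ q))))
theorem9 (suc (suc (suc (suc k)))) (s≤s (s≤s (s≤s (s≤s _)))) =
  let (b , X , Y , 0<X , 0<Y , M<Xⁿ , Yⁿ⁺¹<P , X+1<Y+Y) = approximate-roots 3≤P
      -- With n = 1 + b, e < 1/n allows the upper estimate through X^n, and e > 1/(n+1) the lower
      -- one through Y^(n+1).
      (e , 1/[2+b]<e , e<1/[1+b]) =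
        ℚₚ.<-dense (/-mono-< 1 (suc b) 1 b (*-monoʳ-< 1 (n<1+n (suc b))))
      -- Between rational reals, `_<ℝ_` asks for a rational strictly in between.
      0<ε = ℚₚ.<-dense (ℚₚ.≤-<-trans (0≤1/[1+n] 1 (suc b)) 1/[2+b]<e)
      β   = 1ℝ +ℝ fromℚ e
      0<β = 0<1+ (fromℚ e) 0<ε
      G   = QS (m[ q ] + 1) m[ q ] (m<m+n m[ q ] z<s)
      K   = complete q ⊕ empty (m[ q ] + 1 ∸ q)
  in fromℚ e , 0<ε , ℚₚ.<-dense (ℚₚ.<-≤-trans e<1/[1+b] (1/[1+b]≤1 b)) ,
     ≼-≽⇒<ℝ (powerSum β 0<β (degrees G)) (powerSum β 0<β (degrees K))
       (powerSum-QS-∼ _≼_ (fromℚ-≼ 0ℚ) ≼-+ β 0<β (m[ q ] + 1) m[ q ]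
         (fromℕ m[ q ] ℚ.* X) (m<m+n m[ q ] z<s)
         (power-1+e-≼ e 0<β m[ q ] b X e<1/[1+b] (ℚₚ.<⇒≤ 0<X)
           (ℚₚ.<⇒≤ (subst (ℚ._< X ^ suc b) (sym fromℕ-m) M<Xⁿ)))
         (power-1-≼ e 0<β b e<1/[1+b]))
       (powerSum-complete-∼ _≽_ (fromℚ-≽ 0ℚ) ≽-+ β 0<β (3 + k) (m[ q ] + 1 ∸ q) (P ℚ.* Y)
         -- `suc b` rather than `b`, since the bound below P is for the exponent 2 + b of Y.
         (power-1+e-≽ e 0<β (2 + k) (suc b) Y 1/[2+b]<e (ℚₚ.<⇒≤ Yⁿ⁺¹<P)))
       (subst₂ ℚ._<_
         (cong (λ M → M ℚ.* X ℚ.+ M) (sym fromℕ-m))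
         (cong (ℚ._* (P ℚ.* Y)) (sym (fromℕ-suc (3 + k))))
         (sums-< P (ℚₚ.<-≤-trans (ℚₚ.positive⁻¹ (fromℕ 3)) 3≤P) X+1<Y+Y))
  where
  q = 4 + k
  P = fromℕ (3 + k)
  3≤P = 3≤fromℕ-3+n k
  fromℕ-m = fromℕ-C2 (3 + k)
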